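{- Let $G$ be a finite simple graph with maximum degree at least $2$, and let $\phi$ be a semi-transitive orientation of $G$. Then there exists a path $P=uvw$ of length $2$ in $G$ such that, writing $G'$ for the graph obtained from $G$ by lifting $P$, $\phi$ can be extended to a semi-transitive orientation of $G'$; that is, there is a semi-transitive orientation of $G'$ that agrees with $\phi$ on every edge of $E(G)\cap E(G')$.
   Context: Graphs are finite, undirected and simple. An orientation of a graph assigns to each edge one of its two directions; it is acyclic if it has no directed cycle. A digraph is transitive if whenever $v_1\to v_2$ and $v_2\to v_3$ are directed edges on three distinct vertices, $v_1\to v_3$ is also a directed edge. Given an acyclic orientation $\phi$ of a graph $G$, a shortcut in $\phi(G)$ is a non-transitive induced subdigraph of $\phi(G)$ on a vertex set $\{v_1,\dots,v_n\}$ with $n\ge 4$ (distinct vertices) that contains the directed path $v_1\to v_2\to\cdots\to v_n$ and the directed edge $v_1\to v_n$. An acyclic orientation $\phi$ is semi-transitive if $\phi(G)$ contains no shortcut. A path $uvw$ of length $2$ consists of three distinct vertices with $uv,vw\in E(G)$ (it need not be induced). The graph obtained from $G$ by lifting $uvw$ is the graph obtained from $G$ by removing the edges $uv$ and $vw$ and adding the edge $uw$ if $uw$ was not already an edge. -}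

module Defs where

open import Data.Fin using (Fin; zero; suc; inject₁; fromℕ; _≟_)
open import Data.List using (length; map; filter; allFin)
open import Data.List.Extrema.Nat using (max)
open import Data.Nat using (ℕ; suc; _≥_)
open import Data.Product using (Σ; _×_; _,_; swap)
open import Data.Sum as Sum using (_⊎_; inj₁; inj₂)
open import Function using (_∘_; _on_; _⇔_; Injective)
open import Level using (0ℓ)
open import Relation.Binary
  using (Rel; Symmetric; Irreflexive; Asymmetric; Decidable)
open import Relation.Binary.PropositionalEquality using (_≡_; _≢_; refl; sym; trans)
open import Relation.Nullary using (¬_)
open import Relation.Nullary.Decidable using (_×-dec_; _⊎-dec_; ¬?)

record Graph (n : ℕ) : Set₁ where
  field
    Adj    : Rel (Fin n) 0ℓ
    adj?   : Decidable Adj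
    symm   : Symmetric Adj
    irrefl : Irreflexive _≡_ Adj

  degree : Fin n → ℕ
  degree v = length (filter (adj? v) (allFin n))

  -- The graph with no vertices gets maximum degree 0.
  maxDegree : ℕ
  maxDegree = max 0 (map degree (allFin n))

-- `total` and `asym` together: every edge gets exactly one direction.
record Orientation {n : ℕ} (G : Graph n) : Set₁ where
  open Graph G
  field
    Arc     : Rel (Fin n) 0ℓ
    arc⇒adj : ∀ {x y} → Arc x y → Adj x y
    total   : ∀ {x y} → Adj x y → Arc x y ⊎ Arc y x
    asym    : Asymmetric Arc

module _ {V : Set} (_⟶_ : Rel V 0ℓ) where

  -- The sequence has m + 1 distinct vertices, hence m arcs.
  record DirectedPath (m : ℕ) : Set where
    field
      vertex   : Fin (suc m) → V
      distinct : Injective _≡_ _≡_ vertex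
      step     : ∀ (i : Fin m) → vertex (inject₁ i) ⟶ vertex (suc i)

    first last : V
    first = vertex zero
    last  = vertex (fromℕ m)

  record DirectedCycle : Set where
    field
      {m}    : ℕ
      path   : DirectedPath m
    open DirectedPath path public
    field
      closes : last ⟶ first

  TransitiveDigraph : Set
  TransitiveDigraph = ∀ {x y z} → x ≢ y → y ≢ z → x ≢ z →
                      x ⟶ y → y ⟶ z → x ⟶ z

-- As the vertices of the path are distinct, the subdigraph they induce is
-- `_⟶_ on vertex`, a digraph on the indices.  The condition m ≥ 3 says that
-- there are at least 4 vertices.
record Shortcut {V : Set} (_⟶_ : Rel V 0ℓ) : Set where
  field
    {m}  : ℕ
    m≥3  : m ≥ 3
    path : DirectedPath _⟶_ m
  open DirectedPath path public
  field
    edge          : first ⟶ last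
    nonTransitive : ¬ TransitiveDigraph (_⟶_ on vertex)

module _ {n : ℕ} {G : Graph n} (φ : Orientation G) where
  open Orientation φ

  Acyclic : Set
  Acyclic = ¬ DirectedCycle Arc

  SemiTransitive : Set
  SemiTransitive = Acyclic × ¬ Shortcut Arc

-- u ≢ v and v ≢ w hold because adjacency is irreflexive.
record Path₂ {n : ℕ} (G : Graph n) : Set where
  open Graph G
  field
    u v w : Fin n
    uv    : Adj u v
    vw    : Adj v w
    u≢w   : u ≢ w

-- Equality of the unordered pairs {x , y} and {a , b}.
SamePair : ∀ {n} → (a b x y : Fin n) → Set
SamePair a b x y = (x ≡ a × y ≡ b) ⊎ (x ≡ b × y ≡ a)

samePair? : ∀ {n} (a b : Fin n) → Decidable (SamePair a b)
samePair? a b x y = (x ≟ a ×-dec y ≟ b) ⊎-dec (x ≟ b ×-dec y ≟ a)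

samePair-sym : ∀ {n} {a b : Fin n} → Symmetric (SamePair a b)
samePair-sym = Sum.swap ∘ Sum.map swap swap

lift : ∀ {n} (G : Graph n) → Path₂ G → Graph n
lift {n} G P = record
  { Adj    = Adj′
  ; adj?   = λ x y →
      (adj? x y ×-dec ¬? (samePair? u v x y) ×-dec ¬? (samePair? v w x y))
      ⊎-dec samePair? u w x y
  ; symm   = Sum.map
      (λ (xy , ≠uv , ≠vw) → symm xy , ≠uv ∘ samePair-sym , ≠vw ∘ samePair-sym)
      samePair-sym
  ; irrefl = irrefl′
  }
  where
  open Graph G
  open Path₂ P

  Adj′ : Rel (Fin n) 0ℓ
  Adj′ x y = (Adj x y × ¬ SamePair u v x y × ¬ SamePair v w x y)
             ⊎ SamePair u w x y

  irrefl′ : Irreflexive _≡_ Adj′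
  irrefl′ x≡y (inj₁ (xy , _))              = irrefl x≡y xy
  irrefl′ refl (inj₂ (inj₁ (x≡u , x≡w))) = u≢w (trans (sym x≡u) x≡w)
  irrefl′ refl (inj₂ (inj₂ (x≡w , x≡u))) = u≢w (trans (sym x≡u) x≡w)

Agree : ∀ {n} {G G′ : Graph n} → Orientation G → Orientation G′ → Set
Agree {G = G} {G′} φ φ′ =
  ∀ {x y} → Graph.Adj G x y → Graph.Adj G′ x y →
  Orientation.Arc φ x y ⇔ Orientation.Arc φ′ x y

{-# OPTIONS --safe #-}
-- Write x ≺ y for the existence of a directed walk of length at least 1, and
-- call an arc u → v a cover if nothing lies ≺-between u and v.
--
-- If some directed walk has length 2, take covers u ⋖ v ⋖ w such that no chain
-- u ≺ a ≺ b ≺ w exists: any such chain, refined to covers, gives u ⋖ x ⋖ y with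
-- y ≺ w, so one can descend on w.  Lift u v w and orient the new edge u → w.
-- Concatenating walks from x through a, b, c to y, semi-transitivity says that
-- x → y and x ≼ a ≺ b ≺ c ≼ y imply a → c.  Hence a path of the lifted digraph
-- closed by an old arc induces a transitive digraph, the deleted arcs being
-- covers, and a path of length at least 3 closed by u → w would be a forbidden
-- chain.
--
-- Otherwise every vertex is a source or a sink.  Lift two edges at a vertex of
-- degree at least 2; the new digraph has no directed walk of length 3.
module Submission where

open import Defs
open import Data.Empty using (⊥)
open import Data.Fin using (Fin; zero; suc; toℕ; fromℕ; inject₁; _≟_; _<_; _≤_)
open import Data.Fin.Induction
  using (<-weakInduction-startingFrom; spo-wellFounded; spo-noetherian)
open import Data.Fin.Properties
  using (any?; toℕ-injective; toℕ-inject₁; <-cmp; <⇒≢; ≤∧≢⇒<; ≤fromℕ)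
open import Data.List using ([]; _∷_; length; filter; allFin)
open import Data.List.Extrema.Nat using (max<v⁺)
open import Data.List.Relation.Unary.All using (All; []; _∷_)
open import Data.List.Relation.Unary.All.Properties using (all-filter; map⁺; tabulate⁺)
open import Data.List.Relation.Unary.AllPairs using (_∷_)
open import Data.List.Relation.Unary.Unique.Propositional using (Unique)
open import Data.List.Relation.Unary.Unique.Propositional.Properties
  using (allFin⁺; filter⁺)
open import Data.Nat using (ℕ; zero; suc; _+_; _≥_; _≤?_; z≤n; s≤s)
import Data.Nat.Properties as ℕ
open import Data.Product using (Σ; ∃; ∃₂; _×_; _,_; proj₁)
open import Data.Sum using (_⊎_; inj₁; inj₂; [_,_]′)
open import Function using (_∘_; _on_; flip; mk⇔; Injective)
open import Induction.WellFounded using (Acc; acc; WellFounded)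
open import Level using (0ℓ)
open import Relation.Binary
  using (Rel; Asymmetric; Decidable; IsStrictPartialOrder; tri<; tri≈; tri>)
open import Relation.Binary.PropositionalEquality
  using (_≡_; _≢_; refl; sym; trans; cong; subst; isEquivalence)
open import Relation.Nullary using (¬_; Dec; yes; no; contradiction)
open import Relation.Nullary.Decidable
  using (_×-dec_; _⊎-dec_; decidable-stable; map′)

-- Induction on j from i. As `TransitiveDigraph` speaks of distinct vertices only, the strict
-- inequality is carried along to supply distinctness.
transitive⇒chain : ∀ {m} {_⟶_ : Rel (Fin (suc m)) 0ℓ} → TransitiveDigraph _⟶_ →
                   (∀ i → inject₁ i ⟶ suc i) → ∀ {i j} → i < j → i ⟶ j
transitive⇒chain {m} {_⟶_} tr step {i} {j} i<j
  with <-weakInduction-startingFrom (λ j → i ≡ j ⊎ (i < j × i ⟶ j))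
         (inj₁ refl) extend (ℕ.<⇒≤ i<j)
  where
  inject₁<suc : ∀ (k : Fin m) → inject₁ k < suc k
  inject₁<suc k = s≤s (ℕ.≤-reflexive (toℕ-inject₁ k))

  extend : ∀ k → i ≡ inject₁ k ⊎ (i < inject₁ k × i ⟶ inject₁ k) →
           i ≡ suc k ⊎ (i < suc k × i ⟶ suc k)
  extend k (inj₁ refl)        = inj₂ (inject₁<suc k , step k)
  extend k (inj₂ (i<k , i⟶k)) =
    inj₂ (i<1+k , tr (<⇒≢ i<k) (<⇒≢ (inject₁<suc k)) (<⇒≢ i<1+k) i⟶k (step k))
    where
    i<1+k : i < suc k
    i<1+k = ℕ.<-trans i<k (inject₁<suc k)
... | inj₁ refl      = contradiction i<j (ℕ.<-irrefl refl)
... | inj₂ (_ , i⟶j) = i⟶j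

-- Directed walks

module Walks {V : Set} (_⟶_ : Rel V 0ℓ) where

  infixr 5 _∷_ _++_
  infix 4 _≼_ _≺_ _∈_

  -- Vertices may repeat so that walks concatenate freely; acyclicity restores distinctness in
  -- `walk-injective`.
  data Walk : V → V → ℕ → Set where
    []  : ∀ {x} → Walk x x 0
    _∷_ : ∀ {x y z m} → x ⟶ y → Walk y z m → Walk x z (suc m)

  _≼_ _≺_ : Rel V 0ℓ
  x ≼ y = ∃ λ m → Walk x y m
  x ≺ y = ∃ λ m → Walk x y (suc m)

  _++_ : ∀ {x y z k m} → Walk x y k → Walk y z m → Walk x z (k + m)
  []      ++ q = q
  (r ∷ p) ++ q = r ∷ (p ++ q)

  ≺-trans : ∀ {x y z} → x ≺ y → y ≺ z → x ≺ z
  ≺-trans (_ , p) (_ , q) = _ , p ++ q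

  ≼-≺-trans : ∀ {x y z} → x ≼ y → y ≺ z → x ≺ z
  ≼-≺-trans (_ , [])    y≺z     = y≺z
  ≼-≺-trans (_ , r ∷ p) (_ , q) = _ , r ∷ (p ++ q)

  ≺-≼-trans : ∀ {x y z} → x ≺ y → y ≼ z → x ≺ z
  ≺-≼-trans (_ , p) (_ , q) = _ , p ++ q

  arc⇒≺ : ∀ {x y} → x ⟶ y → x ≺ y
  arc⇒≺ r = _ , r ∷ []

  ≺⇒≼ : ∀ {x y} → x ≺ y → x ≼ y
  ≺⇒≼ (_ , p) = _ , p

  at : ∀ {x y m} → Walk x y m → Fin (suc m) → V
  at {x} _   zero    = x
  at (r ∷ p) (suc i) = at p i

  at-last : ∀ {x y m} (p : Walk x y m) → at p (fromℕ m) ≡ y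
  at-last []      = refl
  at-last (r ∷ p) = at-last p

  at-step : ∀ {x y m} (p : Walk x y m) i → at p (inject₁ i) ⟶ at p (suc i)
  at-step (r ∷ p) zero    = r
  at-step (r ∷ p) (suc i) = at-step p i

  _∈_ : ∀ {x y m} → V → Walk x y m → Set
  a ∈ p = ∃ λ i → at p i ≡ a

  ∈-start : ∀ {x y m} (p : Walk x y m) → x ∈ p
  ∈-start _ = zero , refl

  ∈-++ʳ : ∀ {x y z k m a} (p : Walk x y k) {q : Walk y z m} → a ∈ q → a ∈ p ++ q
  ∈-++ʳ []      a∈q = a∈q
  ∈-++ʳ (r ∷ p) a∈q with i , eq ← ∈-++ʳ p a∈q = suc i , eq

  take : ∀ {x y m} (p : Walk x y m) (i : Fin (suc m)) → Walk x (at p i) (toℕ i)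
  take p       zero    = []
  take (r ∷ p) (suc i) = r ∷ take p i

  at-take : ∀ {x y m} (p : Walk x y m) i j →
            ∃ λ k → toℕ k ≡ toℕ j × at p k ≡ at (take p i) j
  at-take p       zero    zero    = zero , refl , refl
  at-take p       (suc i) zero    = zero , refl , refl
  at-take (r ∷ p) (suc i) (suc j) with k , k≡j , eq ← at-take p i j =
    suc k , cong suc k≡j , eq

  take-injective : ∀ {x y m} (p : Walk x y m) i →
                   Injective _≡_ _≡_ (at p) → Injective _≡_ _≡_ (at (take p i))
  take-injective p i inj {j₁} {j₂} eq
    with k₁ , k₁≡j₁ , eq₁ ← at-take p i j₁
       | k₂ , k₂≡j₂ , eq₂ ← at-take p i j₂
    = toℕ-injective (trans (sym k₁≡j₁) (trans (cong toℕ k₁≡k₂) k₂≡j₂))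
    where
    k₁≡k₂ : k₁ ≡ k₂
    k₁≡k₂ = inj (trans eq₁ (trans eq (sym eq₂)))

  walk⇒path : ∀ {x y m} (p : Walk x y m) → Injective _≡_ _≡_ (at p) →
              DirectedPath _⟶_ m
  walk⇒path p inj = record { vertex = at p ; distinct = inj ; step = at-step p }

-- Reachability in a finite acyclic digraph

module AcyclicDigraph {n} (_⟶_ : Rel (Fin n) 0ℓ) (_⟶?_ : Decidable _⟶_)
                      (noCycle : ¬ DirectedCycle _⟶_) where

  open Walks _⟶_ public

  -- Mutual with `start∉tail`, where a `DirectedCycle` needs distinct vertices; the induction
  -- provides them for the shorter walk.
  walk-injective : ∀ {x y m} (p : Walk x y m) → Injective _≡_ _≡_ (at p)

  -- The part of p before a repetition of x closes up to a directed cycle.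
  start∉tail : ∀ {x y z m} → x ⟶ y → (p : Walk y z m) → ¬ x ∈ p
  start∉tail {x} r p (i , eq) = noCycle record
    { path   = walk⇒path q (take-injective p i (walk-injective p))
    ; closes = subst (_⟶ _) (sym (trans (at-last q) eq)) r
    }
    where q = take p i

  walk-injective p       {zero}  {zero}  eq = refl
  walk-injective (r ∷ p) {zero}  {suc j} eq = contradiction (j , sym eq) (start∉tail r p)
  walk-injective (r ∷ p) {suc i} {zero}  eq = contradiction (i , eq) (start∉tail r p)
  walk-injective (r ∷ p) {suc i} {suc j} eq = cong suc (walk-injective p eq)

  ≺-irrefl : ∀ {x} → ¬ x ≺ x
  ≺-irrefl (_ , r ∷ p) = start∉tail r p (fromℕ _ , at-last p)

  ≺-isStrictPartialOrder : IsStrictPartialOrder _≡_ _≺_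
  ≺-isStrictPartialOrder = record
    { isEquivalence = isEquivalence
    ; irrefl        = λ { refl → ≺-irrefl }
    ; trans         = ≺-trans
    ; <-resp-≈      = (λ { refl x≺y → x≺y }) , (λ { refl x≺y → x≺y })
    }

  ≺-wellFounded : WellFounded _≺_
  ≺-wellFounded = spo-wellFounded ≺-isStrictPartialOrder

  -- Search over first arcs; it terminates since `≺` is a strict order on a finite set, hence
  -- noetherian.
  _≺?_ : Decidable _≺_
  x ≺? z = go x (spo-noetherian ≺-isStrictPartialOrder x)
    where
    open-walk : ∀ {x} → x ≺ z → x ⟶ z ⊎ ∃ λ y → x ⟶ y × y ≺ z
    open-walk (_ , r ∷ [])       = inj₁ r
    open-walk (_ , r ∷ (r′ ∷ p)) = inj₂ (_ , r , _ , r′ ∷ p)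

    go : ∀ x → Acc (flip _≺_) x → Dec (x ≺ z)
    go x (acc rec) =
      map′ (λ { (inj₁ r) → arc⇒≺ r ; (inj₂ (_ , r , y≺z)) → ≺-trans (arc⇒≺ r) y≺z })
           open-walk
           ((x ⟶? z) ⊎-dec any? next?)
      where
      next? : ∀ y → Dec (x ⟶ y × y ≺ z)
      -- The recursive call at y requires `x ≺ y`, so the arc is decided first.
      next? y with x ⟶? y
      ... | no ¬r = no (¬r ∘ proj₁)
      ... | yes r = map′ (r ,_) (λ (_ , y≺z) → y≺z) (go y (rec (arc⇒≺ r)))

  path-≺ : ∀ {m} (vertex : Fin (suc m) → Fin n) →
           (∀ i → vertex (inject₁ i) ≺ vertex (suc i)) →
           ∀ {i j} → i < j → vertex i ≺ vertex j
  path-≺ vertex =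
    transitive⇒chain {_⟶_ = _≺_ on vertex} (λ _ _ _ → ≺-trans)

  path-≼ : ∀ {m} (vertex : Fin (suc m) → Fin n) →
           (∀ i → vertex (inject₁ i) ≺ vertex (suc i)) →
           ∀ {i j} → i ≤ j → vertex i ≼ vertex j
  path-≼ vertex step {i} {j} i≤j with i ≟ j
  ... | yes refl = 0 , []
  ... | no i≢j   = ≺⇒≼ (path-≺ vertex step (≤∧≢⇒< i≤j i≢j))

  -- The path gives `first ≼ last`, with equality for a loop, against `last ≺ first`. This applies
  -- to the lifted digraph, whose new arc replaces a walk of length 2.
  ≺-noCycle : ∀ {_⇝_ : Rel (Fin n) 0ℓ} → (∀ {x y} → x ⇝ y → x ≺ y) →
              ¬ DirectedCycle _⇝_
  ≺-noCycle ⇝⇒≺ C = ≺-irrefl (≼-≺-trans (path-≼ vertex (⇝⇒≺ ∘ step) z≤n) (⇝⇒≺ closes))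
    where open DirectedCycle C

  -- Covers

  Cover : Rel (Fin n) 0ℓ
  Cover u v = u ⟶ v × ¬ ∃ λ y → u ≺ y × y ≺ v

  -- Descent on v: a vertex strictly between is a smaller target. If there is none, a walk from u to
  -- v has a single arc.
  coverBelow : ∀ {u v} → u ≺ v → ∃ λ x → Cover u x × x ≼ v
  coverBelow {u} {v} = go v (≺-wellFounded v)
    where
    go : ∀ v → Acc _≺_ v → u ≺ v → ∃ λ x → Cover u x × x ≼ v
    go v (acc rec) u≺v with any? (λ y → (u ≺? y) ×-dec (y ≺? v))
    go v (acc rec) u≺v | yes (y , u≺y , y≺v)
      with x , ux , x≼y ← go y (rec y≺v) u≺y = x , ux , ≺⇒≼ (≼-≺-trans x≼y y≺v)
    go v (acc rec) (_ , r ∷ [])       | no none = v , (r , none) , 0 , []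
    go v (acc rec) (_ , r ∷ (r′ ∷ p)) | no none =
      contradiction (_ , arc⇒≺ r , _ , r′ ∷ p) none

  Chain₃ : Rel (Fin n) 0ℓ
  Chain₃ u w = ∃₂ λ a b → u ≺ a × a ≺ b × b ≺ w

  coverPairBelow : ∀ {u a b} → u ≺ a → a ≺ b →
                   ∃₂ λ v w → Cover u v × Cover v w × w ≼ b
  coverPairBelow u≺a a≺b
    with v , uv , v≼a ← coverBelow u≺a
    with w , vw , w≼b ← coverBelow (≼-≺-trans v≼a a≺b) = v , w , uv , vw , w≼b

  minimalCoverPair : ∀ {u v w} → Cover u v → Cover v w →
                     ∃₂ λ v w → Cover u v × Cover v w × ¬ Chain₃ u w
  minimalCoverPair {u} {v} {w} = go w (≺-wellFounded w)
    where
    go : ∀ {v} w → Acc _≺_ w → Cover u v → Cover v w →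
         ∃₂ λ v w → Cover u v × Cover v w × ¬ Chain₃ u w
    go w (acc rec) uv vw
      with any? (λ a → any? λ b → (u ≺? a) ×-dec (a ≺? b) ×-dec (b ≺? w))
    ... | no none = _ , w , uv , vw , none
    ... | yes (a , b , u≺a , a≺b , b≺w)
      with v′ , w′ , uv′ , vw′ , w′≼b ← coverPairBelow u≺a a≺b
      = go w′ (rec (≼-≺-trans w′≼b b≺w)) uv′ vw′

  -- A pair with a vertex strictly between is no cover, and a cover in the opposite direction would
  -- close a cycle. So arcs obtained by transitivity survive the deletion of covers.
  between⇒¬SamePair : ∀ {a b x y z} → Cover a b → x ≺ y → y ≺ z → ¬ SamePair a b x z
  between⇒¬SamePair (_ , none) x≺y y≺z (inj₁ (refl , refl)) = none (_ , x≺y , y≺z)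
  between⇒¬SamePair (ab , _)   x≺y y≺z (inj₂ (refl , refl)) =
    ≺-irrefl (≺-trans (arc⇒≺ ab) (≺-trans x≺y y≺z))

  -- Semi-transitivity on intervals

  module SemiTransitiveDigraph (noShortcut : ¬ Shortcut _⟶_) where

    -- Having no shortcut only refutes non-transitivity of the subdigraph induced on the walk;
    -- decidability of the single arc a → c removes the double negation.
    walk-transitive : ∀ {x y m a c} → m ≥ 3 → (p : Walk x y m) → x ⟶ y →
                      a ∈ p → c ∈ p → a ≺ c → a ⟶ c
    walk-transitive m≥3 p xy (i , refl) (k , refl) a≺c =
      decidable-stable (_ ⟶? _) λ ¬ac → noShortcut record
        { m≥3           = m≥3
        ; path          = walk⇒path p (walk-injective p)
        ; edge          = subst (_ ⟶_) (sym (at-last p)) xy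
        ; nonTransitive = λ tr →
            ¬ac (transitive⇒chain {_⟶_ = _⟶_ on at p} tr (at-step p) i<k)
        }
      where
      -- Otherwise a and c would coincide or the walk would lead back from c to a.
      i<k : i < k
      i<k with <-cmp i k
      ... | tri< i<k _ _  = i<k
      ... | tri≈ _ refl _ = contradiction a≺c ≺-irrefl
      ... | tri> _ _ k<i  =
        contradiction (≺-trans a≺c (path-≺ (at p) (arc⇒≺ ∘ at-step p) k<i)) ≺-irrefl

    interval-transitive : ∀ {x y a b c} → x ⟶ y →
                          x ≼ a → a ≺ b → b ≺ c → c ≼ y → a ⟶ c
    interval-transitive {x} {y} {a} {b} {c} xy (k₁ , p₁) (k₂ , p₂) (k₃ , p₃) (k₄ , p₄) =
      split p₁ p₄
      where
      via : ∀ {k₁ k₄} → k₁ + (suc k₂ + (suc k₃ + k₄)) ≥ 3 →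
            Walk x a k₁ → Walk c y k₄ → a ⟶ c
      via long p₁ p₄ = walk-transitive long (p₁ ++ p₂ ++ p₃ ++ p₄) xy
        (∈-++ʳ p₁ (∈-start (p₂ ++ p₃ ++ p₄)))
        (∈-++ʳ p₁ (∈-++ʳ p₂ (∈-++ʳ p₃ (∈-start p₄))))
        (_ , p₂ ++ p₃)

      1≤ : ∀ k → suc k ≥ 1
      1≤ _ = s≤s z≤n

      split : ∀ {k₁ k₄} → Walk x a k₁ → Walk c y k₄ → a ⟶ c
      -- The whole walk may have just 2 arcs here, too few for a shortcut, but a → c is then x → y
      -- itself. A nonempty outer walk brings the length to at least 3.
      split []         []         = xy
      split []         p₄@(_ ∷ _) =
        via (ℕ.+-mono-≤ (1≤ k₂) (ℕ.+-mono-≤ (1≤ k₃) (1≤ _))) [] p₄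
      split p₁@(_ ∷ _) p₄         =
        via (ℕ.+-mono-≤ (1≤ _) (ℕ.+-mono-≤ (1≤ k₂) (ℕ.+-mono-≤ (1≤ k₃) z≤n))) p₁ p₄

-- Orientations of the lifted graph

module _ {n} {G : Graph n} (φ : Orientation G) where
  open Graph G
  open Orientation φ

  arc? : Decidable Arc
  arc? x y with adj? x y
  ... | no ¬xy = no (¬xy ∘ arc⇒adj)
  ... | yes xy with total xy
  ...   | inj₁ x⟶y = yes x⟶y
  ...   | inj₂ y⟶x = no λ x⟶y → asym x⟶y y⟶x

  module Lifting (P : Path₂ G) (¬wu : ¬ Arc (Path₂.w P) (Path₂.u P)) where
    open Path₂ P

    -- If uw is already an edge of G, `¬wu` forces its old arc to be u → w, so asymmetry and
    -- agreement are preserved.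
    LiftArc : Rel (Fin n) 0ℓ
    LiftArc x y = (Arc x y × ¬ SamePair u v x y × ¬ SamePair v w x y)
                  ⊎ (x ≡ u × y ≡ w)

    liftOrientation : Orientation (lift G P)
    liftOrientation = record
      { Arc     = LiftArc
      ; arc⇒adj = λ { (inj₁ (xy , ≠uv , ≠vw)) → inj₁ (arc⇒adj xy , ≠uv , ≠vw)
                    ; (inj₂ eqs)              → inj₂ (inj₁ eqs) }
      ; total   = total′
      ; asym    = asym′
      }
      where
      total′ : ∀ {x y} → Graph.Adj (lift G P) x y → LiftArc x y ⊎ LiftArc y x
      total′ (inj₁ (xy , ≠uv , ≠vw)) with total xy
      ... | inj₁ x⟶y = inj₁ (inj₁ (x⟶y , ≠uv , ≠vw))
      ... | inj₂ y⟶x = inj₂ (inj₁ (y⟶x , ≠uv ∘ samePair-sym , ≠vw ∘ samePair-sym))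
      total′ (inj₂ (inj₁ eqs))         = inj₁ (inj₂ eqs)
      total′ (inj₂ (inj₂ (x≡w , y≡u))) = inj₂ (inj₂ (y≡u , x≡w))

      asym′ : Asymmetric LiftArc
      asym′ (inj₁ (xy , _))      (inj₁ (yx , _))      = asym xy yx
      asym′ (inj₁ (xy , _))      (inj₂ (refl , refl)) = ¬wu xy
      asym′ (inj₂ (refl , refl)) (inj₁ (yx , _))      = ¬wu yx
      asym′ (inj₂ (refl , refl)) (inj₂ (w≡u , _))     = u≢w (sym w≡u)

    agree : Agree φ liftOrientation
    agree {x} {y} xy xy′ = mk⇔ (to xy′) from
      where
      to : Graph.Adj (lift G P) x y → Arc x y → LiftArc x y
      to (inj₁ (_ , ≠uv , ≠vw))      x⟶y = inj₁ (x⟶y , ≠uv , ≠vw)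
      to (inj₂ (inj₁ eqs))           x⟶y = inj₂ eqs
      to (inj₂ (inj₂ (refl , refl))) x⟶y = contradiction x⟶y ¬wu

      from : LiftArc x y → Arc x y
      from (inj₁ (x⟶y , _))     = x⟶y
      from (inj₂ (refl , refl)) with total xy
      ... | inj₁ u⟶w = u⟶w
      ... | inj₂ w⟶u = contradiction w⟶u ¬wu

  Goal : Set₁
  Goal = Σ (Path₂ G) λ P → Σ (Orientation (lift G P)) λ φ′ →
         SemiTransitive φ′ × Agree φ φ′

  liftCoverPair : SemiTransitive φ → ∀ {u a b} → Arc u a → Arc a b → Goal
  liftCoverPair (noCycle , noShortcut) ua ab = lifted
    where
    open AcyclicDigraph Arc arc? noCycle
    open SemiTransitiveDigraph noShortcut

    lifted : Goal
    lifted
      with _ , _ , uv₀ , vw₀ , _ ← coverPairBelow (arc⇒≺ ua) (arc⇒≺ ab)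
      with v , w , uv , vw , ¬chain ← minimalCoverPair uv₀ vw₀
      = P , liftOrientation , (≺-noCycle lift⇒≺ , noShortcut′) , agree
      where
      u≺w = ≺-trans (arc⇒≺ (proj₁ uv)) (arc⇒≺ (proj₁ vw))

      P : Path₂ G
      P = record
        { uv  = arc⇒adj (proj₁ uv)
        ; vw  = arc⇒adj (proj₁ vw)
        ; u≢w = λ { refl → ≺-irrefl u≺w }
        }

      open Lifting P (λ wu → ≺-irrefl (≺-trans u≺w (arc⇒≺ wu)))

      lift⇒≺ : ∀ {x y} → LiftArc x y → x ≺ y
      lift⇒≺ (inj₁ (xy , _))      = arc⇒≺ xy
      lift⇒≺ (inj₂ (refl , refl)) = u≺w

      noShortcut′ : ¬ Shortcut LiftArc
      noShortcut′ S = impossible m≥3 edge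
        where
        open Shortcut S

        impossible : m ≥ 3 → LiftArc first last → ⊥
        -- The closing arc is old. Lifted arcs go up in `≺`, so the vertices at i, j, k lie in its
        -- interval; the arc from i to k is old, and it is kept because j lies strictly between.
        impossible _ (inj₁ (xy , _)) = nonTransitive λ {i} {j} {k} _ _ _ ij jk →
          let i≺j = lift⇒≺ ij
              j≺k = lift⇒≺ jk
          in inj₁ ( interval-transitive xy (path-≼ vertex (lift⇒≺ ∘ step) z≤n) i≺j j≺k
                      (path-≼ vertex (lift⇒≺ ∘ step) (≤fromℕ k))
                  , between⇒¬SamePair uv i≺j j≺k
                  , between⇒¬SamePair vw i≺j j≺k )
        -- The closing arc is u → w; with at least 3 arcs on the path, its vertices 1 and 2 form a
        -- chain between u and w.
        impossible (s≤s (s≤s (s≤s _))) (inj₂ (first≡u , last≡w)) =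
          ¬chain (_ , _ , subst (_≺ vertex (suc zero)) first≡u (lift⇒≺ (step zero))
                        , lift⇒≺ (step (suc zero))
                        , subst (_ ≺_) last≡w
                            (path-≺ vertex (lift⇒≺ ∘ step) (s≤s (s≤s (s≤s z≤n)))))

  -- Orientations in which every vertex is a source or a sink

  module Bipartite (no2 : ∀ {x y z} → Arc x y → ¬ Arc y z) where

    lift2 : (P : Path₂ G) → let open Path₂ P in
            ¬ Arc w u → (∀ x → ¬ Arc x u) ⊎ (∀ x → ¬ Arc w x) → Goal
    lift2 P ¬wu end = P , liftOrientation , (noCycle′ , noShortcut′) , agree
      where
      open Path₂ P
      open Lifting P ¬wu

      -- Old and new arcs must alternate. New, old, new needs an arc w → u; old, new, old needs an
      -- arc into u and one out of w, against `end`.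
      no3 : ∀ {x y z t} → LiftArc x y → LiftArc y z → ¬ LiftArc z t
      no3 (inj₁ (xy , _))      (inj₁ (yz , _))      _                    = no2 xy yz
      no3 (inj₂ (_ , refl))    (inj₂ (w≡u , _))     _                    = u≢w (sym w≡u)
      no3 _                    (inj₂ (_ , refl))    (inj₂ (w≡u , _))     = u≢w (sym w≡u)
      no3 _                    (inj₁ (yz , _))      (inj₁ (zt , _))      = no2 yz zt
      no3 (inj₂ (_ , refl))    (inj₁ (wu , _))      (inj₂ (refl , _))    = ¬wu wu
      no3 (inj₁ (xu , _))      (inj₂ (refl , refl)) (inj₁ (wt , _))      =
        [ (λ source → source _ xu) , (λ sink → sink _ wt) ]′ end

      noCycle′ : ¬ DirectedCycle LiftArc
      noCycle′ C = impossible _ path closes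
        where
        open DirectedCycle C using (path; closes)
        open DirectedPath

        impossible : ∀ m (p : DirectedPath LiftArc m) → ¬ LiftArc (last p) (first p)
        -- Cycles on one or two vertices are traversed repeatedly to obtain three consecutive arcs.
        impossible 0                   p r = no3 r r r
        impossible 1                   p r = no3 (step p zero) r (step p zero)
        impossible 2                   p r = no3 (step p zero) (step p (suc zero)) r
        impossible (suc (suc (suc m))) p r =
          no3 (step p zero) (step p (suc zero)) (step p (suc (suc zero)))

      noShortcut′ : ¬ Shortcut LiftArc
      noShortcut′ S = impossible m≥3 path
        where
        open Shortcut S using (m≥3; path)
        open DirectedPath

        impossible : ∀ {m} → m ≥ 3 → ¬ DirectedPath LiftArc m
        impossible (s≤s (s≤s (s≤s _))) p =
          no3 (step p zero) (step p (suc zero)) (step p (suc (suc zero)))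

    -- By `no2`, v is a source or a sink: in the first case b is a sink, in the second a is a
    -- source.
    liftNeighbours : ∀ {a v b} → Adj v a → Adj v b → a ≢ b → Goal
    liftNeighbours {a} {v} {b} va vb a≢b with total va | total vb
    ... | inj₁ v⟶a | inj₁ v⟶b = lift2
      record { uv = symm va ; vw = vb ; u≢w = a≢b }
      (λ b⟶a → no2 v⟶b b⟶a) (inj₂ λ _ → no2 v⟶b)
    ... | inj₁ v⟶a | inj₂ b⟶v = contradiction v⟶a (no2 b⟶v)
    ... | inj₂ a⟶v | inj₁ v⟶b = contradiction v⟶b (no2 a⟶v)
    ... | inj₂ a⟶v | inj₂ b⟶v = lift2
      record { uv = symm va ; vw = vb ; u≢w = a≢b }
      (λ b⟶a → no2 b⟶a a⟶v) (inj₁ λ _ x⟶a → no2 x⟶a a⟶v)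

-- Vertices of degree at least 2

module _ {n} (G : Graph n) where
  open Graph G

  maxDegree≥2⇒degree≥2 : maxDegree ≥ 2 → ∃ λ v → degree v ≥ 2
  maxDegree≥2⇒degree≥2 Δ≥2 with any? (λ v → 2 ≤? degree v)
  ... | yes found = found
  ... | no none   = contradiction Δ≥2 (ℕ.<⇒≱
    -- `s≤s z≤n` bounds the default maximum 0 below 2.
    (max<v⁺ (s≤s z≤n) (map⁺ (tabulate⁺ λ v → ℕ.≰⇒> λ deg≥2 → none (v , deg≥2)))))

  degree≥2⇒neighbours : ∀ {v} → degree v ≥ 2 → ∃₂ λ a b → Adj v a × Adj v b × a ≢ b
  degree≥2⇒neighbours {v} = pick (all-filter (adj? v) (allFin n))
                                 (filter⁺ (adj? v) (allFin⁺ n))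
    where
    pick : ∀ {xs} → All (Adj v) xs → Unique xs → length xs ≥ 2 →
           ∃₂ λ a b → Adj v a × Adj v b × a ≢ b
    pick (va ∷ vb ∷ _) ((a≢b ∷ _) ∷ _) _ = _ , _ , va , vb , a≢b
    pick (_ ∷ [])       _              (s≤s ())

theorem1p9 : ∀ {n : ℕ} (G : Graph n) → Graph.maxDegree G ≥ 2 →
    (φ : Orientation G) → SemiTransitive φ →
    Σ (Path₂ G) λ P → Σ (Orientation (lift G P)) λ φ′ →
    SemiTransitive φ′ × Agree φ φ′
theorem1p9 G Δ≥2 φ st
  with any? (λ x → any? λ y → any? λ z → arc? φ x y ×-dec arc? φ y z)
... | yes (_ , _ , _ , xy , yz) = liftCoverPair φ st xy yz
... | no none
  with v , deg≥2 ← maxDegree≥2⇒degree≥2 G Δ≥2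
  with a , b , va , vb , a≢b ← degree≥2⇒neighbours G deg≥2
  = Bipartite.liftNeighbours φ (λ xy yz → none (_ , _ , _ , xy , yz)) va vb a≢b
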